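{- Let $F$ be an unsatisfiable CNF formula and let $d$ be the minimum width (equivalently, conical junta degree) of a SubCubeSums refutation of $F$. Then every SubCubeSums refutation of $F\circ\oplus$ has combinatorial size $\exp(\Omega(d))$; that is, there are absolute constants $\varepsilon>0$ and $d_0$ such that, whenever $d\ge d_0$, every SubCubeSums refutation of $F\circ\oplus$ has combinatorial size at least $2^{\varepsilon d}$.
   Context: For a multi-set $F$ of clauses and a total assignment $\alpha$, $\mathrm{viol}_F(\alpha)$ is the number of clauses of $F$ (with multiplicity) falsified by $\alpha$. A SubCubeSums refutation of an unsatisfiable CNF $F$ over variables $X$ is a multi-set $H$ of non-tautologous clauses over $X$ with $\mathrm{viol}_F(\alpha)=1+\mathrm{viol}_H(\alpha)$ for all $\alpha\in\{0,1\}^X$. Its combinatorial size is the number of clauses of $H$ counted with multiplicity; its width (also called conical junta degree) is the maximum number of literals in a clause of $H$ (and $0$ if $H$ is empty). $F\circ\oplus$: replace each variable $x$ of $F$ by two new variables $x_1,x_2$. For each clause $C\in F$ on $w$ variables, include the CNF expansion of the statement that $C$ holds with each $x$ replaced by $x_1\oplus x_2$: for each of the $2^w$ assignments to the $2w$ new variables that falsify this statement, the width-$2w$ clause falsified exactly by that assignment. -}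

module Defs where

open import Data.Bool using (Bool; true; false; not; _xor_; if_then_else_)
import Data.Bool.Properties as Bool
open import Data.Fin using (Fin)
open import Data.Fin.Patterns using (0F; 1F)
import Data.Fin.Properties as Fin
open import Data.Integer using (∣_∣)
open import Data.List using (List; []; _∷_; map; filter; foldr; length; concatMap; deduplicate; allFin; cartesianProduct)
open import Data.List.Membership.Propositional using (_∈_)
open import Data.List.Relation.Unary.All using (All)
open import Data.List.Relation.Unary.Any using (Any; any?)
open import Data.List.Relation.Unary.Unique.Propositional using (Unique)
import Data.List.Relation.Unary.Unique.Propositional.Properties as Unique
import Data.List.Relation.Unary.Unique.DecPropositional.Properties as DecUnique
open import Data.Nat using (ℕ; suc; _*_; _^_; _≤_; _⊔_)
open import Data.Product using (_×_; _,_; proj₁; ∃-syntax)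
open import Data.Product.Properties using (≡-dec)
open import Data.Rational using (ℚ; ↥_; ↧ₙ_)
open import Relation.Binary.Definitions using (DecidableEquality)
open import Relation.Binary.PropositionalEquality using (_≡_; cong)
open import Relation.Nullary using (¬_; Dec; ¬?; does)

Assignment : Set → Set
Assignment X = X → Bool

-- The literal (x , b) is satisfied exactly when x has value b:
-- (x , true) is the literal x and (x , false) is its negation.
Literal : Set → Set
Literal X = X × Bool

-- A finite set of literals, given as a duplicate-free list.
-- Tautologous clauses are allowed.
record Clause (X : Set) : Set where
  constructor clause
  field
    literals : List (Literal X)
    distinct : Unique literals

open Clause public

-- Finite multi-sets of clauses; the order of the list plays no role.
CNF : Set → Set
CNF X = List (Clause X)

private
  variable
    X : Set
    n : ℕ

Satisfies : Assignment X → Clause X → Set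
Satisfies α C = Any (λ (x , b) → α x ≡ b) (literals C)

Falsifies : Assignment X → Clause X → Set
Falsifies α C = ¬ Satisfies α C

falsifies? : (α : Assignment X) (C : Clause X) → Dec (Falsifies α C)
falsifies? α C = ¬? (any? (λ (x , b) → α x Bool.≟ b) (literals C))

Unsatisfiable : CNF X → Set
Unsatisfiable F = ¬ (∃[ α ] All (Satisfies α) F)

Tautologous : Clause X → Set
Tautologous C = ∃[ x ] ((x , true) ∈ literals C × (x , false) ∈ literals C)

viol : CNF X → Assignment X → ℕ
viol F α = length (filter (falsifies? α) F)

IsSubCubeSumsRefutation : CNF X → CNF X → Set
IsSubCubeSumsRefutation F H =
  All (λ C → ¬ Tautologous C) H × (∀ α → viol F α ≡ suc (viol H α))

combinatorialSize : CNF X → ℕ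
combinatorialSize = length

clauseWidth : Clause X → ℕ
clauseWidth C = length (literals C)

width : CNF X → ℕ
width H = foldr _⊔_ 0 (map clauseWidth H)

IsMinimumRefutationWidth : CNF X → ℕ → Set
IsMinimumRefutationWidth F d =
  (∃[ H ] (IsSubCubeSumsRefutation F H × width H ≡ d)) ×
  (∀ H → IsSubCubeSumsRefutation F H → d ≤ width H)

update : DecidableEquality X → Assignment X → X → Bool → Assignment X
update _≟_ α x b y = if does (y ≟ x) then b else α y

-- All assignments to the variables in a duplicate-free list, each listed once
-- and represented by the total assignment that is false outside the list.
assignmentsOn : DecidableEquality X → List X → List (Assignment X)
assignmentsOn _≟_ []       = (λ _ → false) ∷ []
assignmentsOn _≟_ (x ∷ xs) =
  concatMap (λ α → update _≟_ α x false ∷ update _≟_ α x true ∷ [])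
            (assignmentsOn _≟_ xs)

-- The clause on the variables xs falsified exactly by those assignments that
-- agree with α on xs.
clauseExcluding : (xs : List X) → Unique xs → Assignment X → Clause X
clauseExcluding xs xs! α =
  clause (map (λ x → x , not (α x)) xs) (Unique.map⁺ (cong proj₁) xs!)

-- The new variables x₁ , x₂ are (x , 0F) , (x , 1F).
xorAssignment : Assignment (X × Fin 2) → Assignment X
xorAssignment β x = β (x , 0F) xor β (x , 1F)

variables : Clause (Fin n) → List (Fin n)
variables C = deduplicate Fin._≟_ (map proj₁ (literals C))

newVariables : Clause (Fin n) → List (Fin n × Fin 2)
newVariables C = cartesianProduct (variables C) (allFin 2)

newVariables-unique : (C : Clause (Fin n)) → Unique (newVariables C)
newVariables-unique C =
  Unique.cartesianProduct⁺ (DecUnique.deduplicate-! Fin._≟_ (map proj₁ (literals C)))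
                           (Unique.allFin⁺ 2)

-- If C has w variables and is not tautologous, this has 2 ^ w clauses, all of
-- width 2 * w; if C is tautologous, it is empty.
xorifyClause : Clause (Fin n) → CNF (Fin n × Fin 2)
xorifyClause C =
  map (clauseExcluding (newVariables C) (newVariables-unique C))
      (filter (λ β → falsifies? (xorAssignment β) C)
              (assignmentsOn (≡-dec Fin._≟_ Fin._≟_) (newVariables C)))

infix 10 _∘⊕

_∘⊕ : CNF (Fin n) → CNF (Fin n × Fin 2)
F ∘⊕ = concatMap xorifyClause F

-- 2 ^ (ε * d) ≤ s for a positive rational ε = p / q, with both sides raised to
-- the power q: 2 ^ (p * d) ≤ s ^ q.
2^[_*_]≤_ : ℚ → ℕ → ℕ → Set
2^[ ε * d ]≤ s = 2 ^ (∣ ↥ ε ∣ * d) ≤ s ^ (↧ₙ ε)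

{-# OPTIONS --safe #-}

-- Choose for every x, uniformly at random, one of x₁ , x₂ and a bit to fix it to;
-- the other copy becomes x up to negation, and F ∘⊕ becomes F. A clause of H
-- mentioning k of the variables x survives with probability at most (3/4)^k, so
-- if |H| < (4/3)^d, some restriction satisfies every clause mentioning at least d
-- of them. It turns H into a refutation of F of width less than d.
-- Hence |H| ≥ (4/3)^d ≥ 2^(d/3).

module Submission where

open import Defs
open import Data.Bool using (Bool; true; false; not; _xor_; if_then_else_)
import Data.Bool.Properties as Bool
open import Data.Nat using (ℕ; zero; suc; _+_; _*_; _^_; _≤_; z≤n; s≤s; _≤?_; _<?_)
  renaming (_<_ to _<ℕ_)
open import Data.Nat.ListAction using (sum; product)
open import Data.Nat.Properties
open import Data.Nat.Tactic.RingSolver using (solve-∀)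
open import Data.Fin using (Fin; opposite)
open import Data.Fin.Patterns using (0F; 1F)
import Data.Fin.Properties as Fin
import Data.Integer as ℤ
open import Data.List
  using (List; []; _∷_; _++_; map; filter; length; concatMap; allFin; cartesianProduct)
open import Data.List.Properties
  using (length-filter; filter-notAll; filter-accept; filter-reject; filter-none;
          filter-++; length-++; length-map)
open import Data.List.Membership.Propositional using (_∈_; find; lose)
open import Data.List.Membership.Propositional.Properties
  using (∈-allFin; ∈-filter⁺; ∈-filter⁻; ∈-map⁺; ∈-deduplicate⁺; ∈-cartesianProduct⁺)
import Data.List.Membership.DecPropositional as DecMembership
open import Data.List.Relation.Unary.All as All using (All; []; _∷_)
import Data.List.Relation.Unary.All.Properties as All
open import Data.List.Relation.Unary.Any as Any using (Any; here; there; any?)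
import Data.List.Relation.Unary.Any.Properties as Any
open import Data.List.Relation.Unary.AllPairs using ([]; _∷_)
open import Data.List.Relation.Unary.Unique.Propositional using (Unique)
import Data.List.Relation.Unary.Unique.Propositional.Properties as Unique
open import Data.List.Relation.Binary.Sublist.Propositional using (⊆-refl)
open import Data.List.Relation.Binary.Sublist.Propositional.Properties using (filter⁺; length-mono-≤)
open import Data.Product using (_×_; _,_; proj₁; proj₂; ∃-syntax)
open import Data.Product.Properties using (≡-dec)
open import Data.Rational using (0ℚ; _<_; _/_; *<*)
open import Data.Sum using (_⊎_; inj₁; inj₂)
open import Level using (0ℓ)
open import Function using (_∘_)
open import Relation.Binary.Definitions using (DecidableEquality)
open import Relation.Binary.PropositionalEquality
  using (_≡_; _≢_; refl; sym; trans; cong; cong₂; subst; module ≡-Reasoning)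
open import Relation.Nullary using (¬_; Dec; yes; no; ¬?; does; contradiction)
open import Relation.Nullary.Decidable using (_⊎-dec_)
open import Relation.Unary using (Pred; Decidable)

-- Overriding a function at one point

module Override {A X : Set} (_≟_ : DecidableEquality X) where

  override : X → A → (X → A) → X → A
  override x c ρ y = if does (y ≟ x) then c else ρ y

  override-≡ : ∀ x c ρ → override x c ρ x ≡ c
  override-≡ x c ρ with x ≟ x
  ... | yes _  = refl
  ... | no x≢x = contradiction refl x≢x

  override-≢ : ∀ {x y} c ρ → x ≢ y → override x c ρ y ≡ ρ y
  override-≢ {x} {y} c ρ x≢y with y ≟ x
  ... | yes y≡x = contradiction (sym y≡x) x≢y
  ... | no _    = refl

-- Hitting sets by conditional expectations

module Hitting {A B X : Set} {Hit : B → X → A → Set}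
               (hit? : ∀ b x c → Dec (Hit b x c)) where

  survivors : X → A → List B → List B
  survivors x c = filter (λ b → ¬? (hit? b x c))

  misses : List A → B → X → ℕ
  misses cs b x = length (filter (λ c → ¬? (hit? b x c)) cs)

  -- The number of ways to pick an entry of `cs` for each entry of `xs` so that no pick hits `b`.
  -- Divided by `length cs ^ length xs` it is the probability that independent uniform picks all
  -- miss `b`; counting instead keeps everything in `ℕ`.
  escapes : List A → List X → B → ℕ
  escapes cs xs b = product (map (misses cs b) xs)

  -- Double counting: the entry `c` adds one further `w b` for precisely those `b` that it does not
  -- hit. Iterated over the list, this turns the sum weighted by `misses` into the sum over all
  -- choices of the weight that survives.
  sum-misses-∷ : ∀ x c cs (w : B → ℕ) bs →
    sum (map (λ b → misses (c ∷ cs) b x * w b) bs) ≡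
    sum (map w (survivors x c bs)) + sum (map (λ b → misses cs b x * w b) bs)
  sum-misses-∷ x c cs w [] = refl
  sum-misses-∷ x c cs w (b ∷ bs) with hit? b x c
  ... | yes _ = begin
      m + sum (map (λ b → misses (c ∷ cs) b x * w b) bs) ≡⟨ cong (m +_) (sum-misses-∷ x c cs w bs) ⟩
      m + (s + r)                                        ≡⟨ lemma m s r ⟩
      s + (m + r)                                        ∎
    where
    open ≡-Reasoning
    m = misses cs b x * w b
    s = sum (map w (survivors x c bs))
    r = sum (map (λ b → misses cs b x * w b) bs)
    lemma : ∀ m s r → m + (s + r) ≡ s + (m + r)
    lemma = solve-∀
  ... | no _ = begin
      w b + m + sum (map (λ b → misses (c ∷ cs) b x * w b) bs) ≡⟨ cong (w b + m +_) (sum-misses-∷ x c cs w bs) ⟩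
      w b + m + (s + r)                                        ≡⟨ lemma (w b) m s r ⟩
      w b + s + (m + r)                                        ∎
    where
    open ≡-Reasoning
    m = misses cs b x * w b
    s = sum (map w (survivors x c bs))
    r = sum (map (λ b → misses cs b x * w b) bs)
    lemma : ∀ v m s r → v + m + (s + r) ≡ v + s + (m + r)
    lemma = solve-∀

  -- Averaging: by `sum-misses-∷` the left side adds up the surviving weights of all entries of
  -- `cs`, so they cannot all be at least `M`.
  choice-below-average : ∀ x (w : B → ℕ) bs M cs →
    sum (map (λ b → misses cs b x * w b) bs) <ℕ length cs * M →
    ∃[ c ] sum (map w (survivors x c bs)) <ℕ M
  choice-below-average x w bs M (c ∷ cs) total<
    with sum (map w (survivors x c bs)) <? M
  ... | yes s<M = c , s<M
  ... | no  s≮M = choice-below-average x w bs M cs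
    -- The rejected `c` accounts for at least `M` of the total, so removing `M` from both sides
    -- leaves the same inequality for the remaining choices.
    (+-cancelˡ-< M _ _ (≤-<-trans (+-monoˡ-≤ _ (≮⇒≥ s≮M))
      (subst (_<ℕ M + length cs * M) (sum-misses-∷ x c cs w bs) total<)))

  module _ (_≟_ : DecidableEquality X) where

    open Override {A} _≟_

    HitsOn : (X → A) → List X → B → Set
    HitsOn ρ xs b = Any (λ x → Hit b x (ρ x)) xs

    HitsOn-there : ∀ {x xs} c ρ → All (x ≢_) xs → ∀ {b} →
                   HitsOn ρ xs b → HitsOn (override x c ρ) xs b
    HitsOn-there c ρ (x≢y ∷ _) {b} (here hit) =
      here (subst (Hit b _) (sym (override-≢ c ρ x≢y)) hit)
    HitsOn-there c ρ (_ ∷ x∉ys) (there hits) = there (HitsOn-there c ρ x∉ys hits)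

    HitsOn-∷ : ∀ {x xs} c ρ → All (x ≢_) xs → ∀ bs →
               All (HitsOn ρ xs) (survivors x c bs) →
               All (HitsOn (override x c ρ) (x ∷ xs)) bs
    HitsOn-∷ c ρ x∉xs [] _ = []
    HitsOn-∷ {x} c ρ x∉xs (b ∷ bs) hits with hit? b x c
    ... | yes hit = here (subst (Hit b x) (sym (override-≡ x c ρ)) hit)
                    ∷ HitsOn-∷ c ρ x∉xs bs hits
    HitsOn-∷ {x} c ρ x∉xs (b ∷ bs) (h ∷ hits) | no _ =
      there (HitsOn-there c ρ x∉xs h) ∷ HitsOn-∷ c ρ x∉xs bs hits

    -- The hypothesis says that a random assignment leaves less than one member of `bs` unhit in
    -- expectation. Fixing the coordinates one at a time, each to a value that keeps the conditional
    -- expectation below one, leaves nothing unhit at the end.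
    hitting : ∀ (c₀ : A) cs xs → Unique xs → ∀ bs →
              sum (map (escapes cs xs) bs) <ℕ length cs ^ length xs →
              ∃[ ρ ] All (HitsOn ρ xs) bs
    -- `c₀` is only the default value outside the listed coordinates.
    hitting c₀ cs [] _ [] _ = (λ _ → c₀) , []
    -- With no coordinate left, every remaining member has weight 1, the empty product, while the
    -- bound is also 1.
    hitting c₀ cs [] _ (_ ∷ _) (s≤s ())
    hitting c₀ cs (x ∷ xs) (x∉xs ∷ xs!) bs total<
      -- `escapes` on `x ∷ xs` unfolds to `misses` at `x` times `escapes` on `xs`, and the bound
      -- unfolds likewise, so `M` is `length cs ^ length xs`.
      with c , below ← choice-below-average x (escapes cs xs) bs _ cs total<
      with ρ , hits ← hitting c₀ cs xs xs! (survivors x c bs) below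
      = override x c ρ , HitsOn-∷ c ρ x∉xs bs hits

  Hittable : List A → B → X → Set
  Hittable cs b x = Any (Hit b x) cs

  hittable? : ∀ cs b → Decidable (Hittable cs b)
  hittable? cs b x = any? (hit? b x) cs

  misses-hittable : ∀ {cs b x k} → length cs ≡ suc k → Hittable cs b x → misses cs b x ≤ k
  misses-hittable {cs} {b} {x} |cs|≡ hittable =
    ≤-pred (subst (misses cs b x <ℕ_) |cs|≡
      (filter-notAll (λ c → ¬? (hit? b x c)) cs (Any.map (λ hit ¬hit → ¬hit hit) hittable)))

  -- Each hittable coordinate is missed with probability at most `k / suc k`, and the coordinates
  -- are independent, so `d` of them are all missed with probability at most the `d`-th power. Both
  -- denominators have been multiplied out.
  escapes-≤ : ∀ {k} cs → length cs ≡ suc k → ∀ b xs d →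
    d ≤ length (filter (hittable? cs b) xs) →
    escapes cs xs b * suc k ^ d ≤ k ^ d * suc k ^ length xs
  escapes-≤ cs _ b [] zero _ = ≤-refl
  escapes-≤ {k} cs |cs|≡ b (x ∷ xs) d d≤ = step d (hittable? cs b x) d≤
    where
    open ≤-Reasoning
    K = suc k
    m = misses cs b x
    e = escapes cs xs b
    l = length xs

    m≤K : m ≤ K
    m≤K = subst (m ≤_) |cs|≡ (length-filter (λ c → ¬? (hit? b x c)) cs)

    factor-out : ∀ m e p → m * e * p ≡ m * (e * p)
    factor-out = solve-∀

    factor-in : ∀ K p q → K * (p * q) ≡ p * (K * q)
    factor-in = solve-∀

    factor-out′ : ∀ m e K p → m * e * (K * p) ≡ m * (K * (e * p))
    factor-out′ = solve-∀

    factor-in′ : ∀ k K p q → k * (K * (p * q)) ≡ k * p * (K * q)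
    factor-in′ = solve-∀

    -- The trivial bound `K` on the factor of `x`, for a coordinate that is not hittable or when no
    -- further factor `k` is required.
    unhit : ∀ d → d ≤ length (filter (hittable? cs b) xs) →
            m * e * K ^ d ≤ k ^ d * (K * K ^ l)
    unhit d d≤ = begin
      m * e * K ^ d         ≡⟨ factor-out m e (K ^ d) ⟩
      m * (e * K ^ d)       ≤⟨ *-mono-≤ m≤K (escapes-≤ cs |cs|≡ b xs d d≤) ⟩
      K * (k ^ d * K ^ l)   ≡⟨ factor-in K (k ^ d) (K ^ l) ⟩
      k ^ d * (K * K ^ l)   ∎

    hit : ∀ d → Hittable cs b x → d ≤ length (filter (hittable? cs b) xs) →
          m * e * (K * K ^ d) ≤ k * k ^ d * (K * K ^ l)
    hit d hittable d≤ = begin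
      m * e * (K * K ^ d)         ≡⟨ factor-out′ m e K (K ^ d) ⟩
      m * (K * (e * K ^ d))       ≤⟨ *-mono-≤ (misses-hittable |cs|≡ hittable) (*-monoʳ-≤ K (escapes-≤ cs |cs|≡ b xs d d≤)) ⟩
      k * (K * (k ^ d * K ^ l))   ≡⟨ factor-in′ k K (k ^ d) (K ^ l) ⟩
      k * k ^ d * (K * K ^ l)     ∎

    step : ∀ d → Dec (Hittable cs b x) →
           d ≤ length (filter (hittable? cs b) (x ∷ xs)) →
           m * e * K ^ d ≤ k ^ d * (K * K ^ l)
    step zero    _         _  = unhit zero z≤n
    step (suc d) (yes hittable) d≤ = hit d hittable
      (≤-pred (subst (λ ys → suc d ≤ length ys) (filter-accept (hittable? cs b) hittable) d≤))
    step (suc d) (no ¬hittable) d≤ = unhit (suc d)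
      (subst (λ ys → suc d ≤ length ys) (filter-reject (hittable? cs b) ¬hittable) d≤)

  -- Linearity of expectation over `bs`, again without denominators.
  sum-escapes-≤ : ∀ {k} cs → length cs ≡ suc k → ∀ xs d bs →
    All (λ b → d ≤ length (filter (hittable? cs b) xs)) bs →
    sum (map (escapes cs xs) bs) * suc k ^ d ≤ length bs * k ^ d * suc k ^ length xs
  sum-escapes-≤ cs |cs|≡ xs d [] [] = z≤n
  sum-escapes-≤ {k} cs |cs|≡ xs d (b ∷ bs) (d≤ ∷ ds≤) = begin
    (e + s) * K ^ d                                      ≡⟨ *-distribʳ-+ (K ^ d) e s ⟩
    e * K ^ d + s * K ^ d                                ≤⟨ +-mono-≤ (escapes-≤ cs |cs|≡ b xs d d≤) (sum-escapes-≤ cs |cs|≡ xs d bs ds≤) ⟩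
    k ^ d * K ^ length xs + length bs * k ^ d * K ^ length xs
                                                         ≡⟨ sym (*-distribʳ-+ (K ^ length xs) (k ^ d) (length bs * k ^ d)) ⟩
    suc (length bs) * k ^ d * K ^ length xs              ∎
    where
    open ≤-Reasoning
    K = suc k
    e = escapes cs xs b
    s = sum (map (escapes cs xs) bs)

-- Lengths of filtered lists

module _ {A : Set} {P : Pred A 0ℓ} (P? : Decidable P) where

  length-filter-accept : ∀ {x xs} → P x → length (filter P? (x ∷ xs)) ≡ suc (length (filter P? xs))
  length-filter-accept Px = cong length (filter-accept P? Px)

  length-filter-reject : ∀ {x xs} → ¬ P x → length (filter P? (x ∷ xs)) ≡ length (filter P? xs)
  length-filter-reject ¬Px = cong length (filter-reject P? ¬Px)

-- The inner filter discards nothing that is counted, since `R` implies `P`; on what remains `R` and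
-- `Q ∘ g` coincide. It serves to count the falsified clauses of `xorifyClause` through the
-- assignments that they exclude.
length-filter-map-filter :
  {A B : Set} {P R : Pred A 0ℓ} {Q : Pred B 0ℓ}
  (P? : Decidable P) (Q? : Decidable Q) (R? : Decidable R) (g : A → B) →
  (∀ {a} → R a → P a × Q (g a)) → (∀ {a} → Q (g a) → R a) → ∀ as →
  length (filter Q? (map g (filter P? as))) ≡ length (filter R? as)
length-filter-map-filter P? Q? R? g to from [] = refl
length-filter-map-filter P? Q? R? g to from (a ∷ as) with P? a | R? a
... | yes _  | yes r = trans (length-filter-accept Q? (proj₂ (to r)))
                             (cong suc (length-filter-map-filter P? Q? R? g to from as))
... | yes _  | no ¬r = trans (length-filter-reject Q? (¬r ∘ from))
                             (length-filter-map-filter P? Q? R? g to from as)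
... | no ¬p  | yes r = contradiction (proj₁ (to r)) ¬p
... | no _   | no _  = length-filter-map-filter P? Q? R? g to from as

-- Violations of F ∘⊕

module _ {X : Set} where

  Agrees : List X → Assignment X → Assignment X → Set
  Agrees xs β γ = All (λ x → γ x ≡ β x) xs

  agrees? : ∀ xs β → Decidable (Agrees xs β)
  agrees? xs β γ = All.all? (λ x → γ x Bool.≟ β x) xs

  satisfies-cong : ∀ {α β} (C : Clause X) → All (λ (x , _) → α x ≡ β x) (literals C) →
                   Satisfies α C → Satisfies β C
  satisfies-cong C α≗β sat =
    let (l , l∈C , αl) = find sat in lose l∈C (trans (sym (All.lookup α≗β l∈C)) αl)

  agrees⇒falsifies-excluding : ∀ {xs xs! β γ} → Agrees xs β γ →
                               Falsifies β (clauseExcluding xs xs! γ)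
  agrees⇒falsifies-excluding agrees sat =
    let (x , x∈xs , β≡notγ) = find (Any.map⁻ sat)
    in Bool.not-¬ (sym (All.lookup agrees x∈xs)) β≡notγ

  falsifies-excluding⇒agrees : ∀ {xs xs! β γ} → Falsifies β (clauseExcluding xs xs! γ) →
                               Agrees xs β γ
  falsifies-excluding⇒agrees falsifies =
    All.map (λ β≢notγ → sym (trans (Bool.¬-not β≢notγ) (Bool.not-involutive _)))
            (All.map⁻ (All.¬Any⇒All¬ _ falsifies))

  module _ (_≟_ : DecidableEquality X) where

    open Override {Bool} _≟_

    agrees-∷⁺ : ∀ {x xs β γ b} → All (x ≢_) xs → b ≡ β x → Agrees xs β γ →
                Agrees (x ∷ xs) β (update _≟_ γ x b)
    agrees-∷⁺ {x} {γ = γ} {b} x∉xs b≡ agrees =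
      trans (override-≡ x b γ) b≡ ∷
      All.zipWith (λ (x≢y , γy≡) → trans (override-≢ b γ x≢y) γy≡) (x∉xs , agrees)

    agrees-∷⁻ : ∀ {x xs β γ b} → All (x ≢_) xs →
                Agrees (x ∷ xs) β (update _≟_ γ x b) → b ≡ β x × Agrees xs β γ
    agrees-∷⁻ {x} {γ = γ} {b} x∉xs (b≡ ∷ agrees) =
      trans (sym (override-≡ x b γ)) b≡ ,
      All.zipWith (λ (x≢y , γy≡) → trans (sym (override-≢ b γ x≢y)) γy≡) (x∉xs , agrees)

    -- Of the two extensions of an agreeing `γ` to the fresh variable `x`, one matches `β x` and the
    -- other does not; a disagreeing `γ` has no agreeing extension.
    agreeing-extensions : ∀ {x xs} β → All (x ≢_) xs → ∀ γs →
      length (filter (agrees? (x ∷ xs) β)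
                     (concatMap (λ γ → update _≟_ γ x false ∷ update _≟_ γ x true ∷ []) γs)) ≡
      length (filter (agrees? xs β) γs)
    agreeing-extensions β x∉xs [] = refl
    agreeing-extensions {x} {xs} β x∉xs (γ ∷ γs) = step (agrees? xs β γ) (β x) refl
      where
      ext = concatMap (λ γ → update _≟_ γ x false ∷ update _≟_ γ x true ∷ [])
      agrees′? = agrees? (x ∷ xs) β
      ih = agreeing-extensions β x∉xs γs

      mismatch : ∀ {b c} → b ≢ c → β x ≡ c → ¬ Agrees (x ∷ xs) β (update _≟_ γ x b)
      mismatch b≢c βx≡c agrees = b≢c (trans (proj₁ (agrees-∷⁻ x∉xs agrees)) βx≡c)

      step : Dec (Agrees xs β γ) → ∀ b → β x ≡ b →
             length (filter agrees′? (ext (γ ∷ γs))) ≡ length (filter (agrees? xs β) (γ ∷ γs))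
      step (no ¬a) _ _ =
        trans (length-filter-reject agrees′? (¬a ∘ proj₂ ∘ agrees-∷⁻ x∉xs))
        (trans (length-filter-reject agrees′? (¬a ∘ proj₂ ∘ agrees-∷⁻ x∉xs))
        (trans ih (sym (length-filter-reject (agrees? xs β) ¬a))))
      step (yes a) false βx≡ =
        trans (length-filter-accept agrees′? (agrees-∷⁺ x∉xs (sym βx≡) a))
        (trans (cong suc (length-filter-reject agrees′? (mismatch (λ ()) βx≡)))
        (trans (cong suc ih) (sym (length-filter-accept (agrees? xs β) a))))
      step (yes a) true βx≡ =
        trans (length-filter-reject agrees′? (mismatch (λ ()) βx≡))
        (trans (length-filter-accept agrees′? (agrees-∷⁺ x∉xs (sym βx≡) a))
        (trans (cong suc ih) (sym (length-filter-accept (agrees? xs β) a))))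

    exactly-one-agrees : ∀ xs → Unique xs → ∀ β →
                         length (filter (agrees? xs β) (assignmentsOn _≟_ xs)) ≡ 1
    exactly-one-agrees [] _ β = refl
    exactly-one-agrees (x ∷ xs) (x∉xs ∷ xs!) β =
      trans (agreeing-extensions β x∉xs (assignmentsOn _≟_ xs)) (exactly-one-agrees xs xs! β)

module _ {n : ℕ} {α : Assignment (Fin n)} {β : Assignment (Fin n × Fin 2)}
         (xor≗ : ∀ x → xorAssignment β x ≡ α x) where

  -- Both copies of every variable of `C` belong to `newVariables C`, so agreement there fixes the
  -- xor of each pair.
  agrees⇒xor-≡ : ∀ C {γ} → Agrees (newVariables C) β γ →
                 All (λ (x , _) → xorAssignment γ x ≡ α x) (literals C)
  agrees⇒xor-≡ C agrees = All.tabulate λ {(x , _)} l∈C →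
    let new∈ : ∀ j → (x , j) ∈ newVariables C
        new∈ j = ∈-cartesianProduct⁺ (∈-deduplicate⁺ Fin._≟_ (∈-map⁺ proj₁ l∈C)) (∈-allFin j)
    in trans (cong₂ _xor_ (All.lookup agrees (new∈ 0F)) (All.lookup agrees (new∈ 1F))) (xor≗ x)

  private
    _≟₂_ : DecidableEquality (Fin n × Fin 2)
    _≟₂_ = ≡-dec Fin._≟_ Fin._≟_

  -- A clause excluding `γ` is falsified by `β` just when `γ` agrees with `β` on the new variables.
  -- One listed `γ` does, and it passes the filter because its xor coincides with `α` on `C`.
  viol-xorifyClause-falsified : ∀ C → Falsifies α C → viol (xorifyClause C) β ≡ 1
  viol-xorifyClause-falsified C falsifies = trans
    (length-filter-map-filter
      (λ γ → falsifies? (xorAssignment γ) C) (falsifies? β) (agrees? (newVariables C) β)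
      (clauseExcluding (newVariables C) (newVariables-unique C))
      (λ agrees → falsifies ∘ satisfies-cong C (agrees⇒xor-≡ C agrees) ,
                  agrees⇒falsifies-excluding {xs! = newVariables-unique C} agrees)
      (falsifies-excluding⇒agrees {xs! = newVariables-unique C})
      (assignmentsOn _≟₂_ (newVariables C)))
    (exactly-one-agrees _≟₂_ (newVariables C) (newVariables-unique C) β)

  -- A falsified clause would exclude some `γ` that agrees with `β`; the xor of that `γ` falsifies
  -- `C`, hence so would `α`.
  viol-xorifyClause-satisfied : ∀ C → ¬ Falsifies α C → viol (xorifyClause C) β ≡ 0
  viol-xorifyClause-satisfied C ¬falsifies = cong length (filter-none (falsifies? β)
    (All.map⁺ (All.map
      (λ {γ} xorFalsifies falsifies → ¬falsifies (xorFalsifies ∘ satisfies-cong C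
        (All.map sym (agrees⇒xor-≡ C (falsifies-excluding⇒agrees {xs! = newVariables-unique C} falsifies)))))
      (All.all-filter (λ γ → falsifies? (xorAssignment γ) C) (assignmentsOn _≟₂_ (newVariables C))))))

  viol-∘⊕ : ∀ F → viol (F ∘⊕) β ≡ viol F α
  viol-∘⊕ [] = refl
  viol-∘⊕ (C ∷ F) = begin
    viol (xorifyClause C ++ F ∘⊕) β           ≡⟨ cong length (filter-++ (falsifies? β) (xorifyClause C) (F ∘⊕)) ⟩
    length (filter (falsifies? β) (xorifyClause C) ++ filter (falsifies? β) (F ∘⊕))
                                              ≡⟨ length-++ (filter (falsifies? β) (xorifyClause C)) ⟩
    viol (xorifyClause C) β + viol (F ∘⊕) β   ≡⟨ cong (viol (xorifyClause C) β +_) (viol-∘⊕ F) ⟩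
    viol (xorifyClause C) β + viol F α        ≡⟨ step (falsifies? α C) ⟩
    viol (C ∷ F) α                            ∎
    where
    open ≡-Reasoning
    step : Dec (Falsifies α C) → viol (xorifyClause C) β + viol F α ≡ viol (C ∷ F) α
    step (yes f) = trans (cong (_+ viol F α) (viol-xorifyClause-falsified C f))
                         (sym (length-filter-accept (falsifies? α) f))
    step (no ¬f) = trans (cong (_+ viol F α) (viol-xorifyClause-satisfied C ¬f))
                         (sym (length-filter-reject (falsifies? α) ¬f))

-- Restrictions

_∈lits?_ : ∀ {n} (l : Literal (Fin n × Fin 2)) ls → Dec (l ∈ ls)
_∈lits?_ = DecMembership._∈?_ (≡-dec (≡-dec Fin._≟_ Fin._≟_) Bool._≟_)

xor-cancelʳ : ∀ a b → (a xor b) xor b ≡ a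
xor-cancelʳ false false = refl
xor-cancelʳ false true  = refl
xor-cancelʳ true  false = refl
xor-cancelʳ true  true  = refl

-- The values of (x₁ , x₂) when x_j is fixed to b and x₁ ⊕ x₂ = a.
setting : Fin 2 × Bool → Bool → Fin 2 → Bool
setting (0F , b) a 0F = b
setting (0F , b) a 1F = a xor b
setting (1F , b) a 0F = a xor b
setting (1F , b) a 1F = b

setting-fixed : ∀ r a → setting r a (proj₁ r) ≡ proj₂ r
setting-fixed (0F , b) a = refl
setting-fixed (1F , b) a = refl

setting-free : ∀ r a → setting r a (opposite (proj₁ r)) ≡ a xor proj₂ r
setting-free (0F , b) a = refl
setting-free (1F , b) a = refl

setting-xor : ∀ r a → setting r a 0F xor setting r a 1F ≡ a
setting-xor (0F , b) a = trans (Bool.xor-comm b (a xor b)) (xor-cancelʳ a b)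
setting-xor (1F , b) a = xor-cancelʳ a b

fixed-or-free : ∀ (i j : Fin 2) → j ≡ i ⊎ j ≡ opposite i
fixed-or-free 0F 0F = inj₁ refl
fixed-or-free 0F 1F = inj₂ refl
fixed-or-free 1F 0F = inj₂ refl
fixed-or-free 1F 1F = inj₁ refl

bools : List Bool
bools = true ∷ false ∷ []

choices : List (Fin 2 × Bool)
choices = cartesianProduct (allFin 2) bools

∈-choices : ∀ c → c ∈ choices
∈-choices (i , true)  = ∈-cartesianProduct⁺ {ys = bools} (∈-allFin i) (here refl)
∈-choices (i , false) = ∈-cartesianProduct⁺ {ys = bools} (∈-allFin i) (there (here refl))

-- The `Hit` relation of the application: choosing to fix copy `i` of `x` to `b` makes this literal
-- true and thereby satisfies `D`.
Occurs : ∀ {n} → Clause (Fin n × Fin 2) → Fin n → Fin 2 × Bool → Set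
Occurs D x (i , b) = ((x , i) , b) ∈ literals D

occurs? : ∀ {n} (D : Clause (Fin n × Fin 2)) x c → Dec (Occurs D x c)
occurs? D x (i , b) = ((x , i) , b) ∈lits? literals D

∈-graph⁻ : {A B : Set} (f : A → B) → ∀ xs {x y} → (x , y) ∈ map (λ x → x , f x) xs → y ≡ f x
∈-graph⁻ f (_ ∷ _)  (here refl) = refl
∈-graph⁻ f (_ ∷ xs) (there ∈xs) = ∈-graph⁻ f xs ∈xs

module Restriction {n : ℕ} (ρ : Fin n → Fin 2 × Bool) where

  free : Fin n → Fin n × Fin 2
  free x = x , opposite (proj₁ (ρ x))

  offset : Fin n → Bool
  offset x = proj₂ (ρ x)

  extend : Assignment (Fin n) → Assignment (Fin n × Fin 2)
  extend α (x , j) = setting (ρ x) (α x) j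

  FreeOccurs : Clause (Fin n × Fin 2) → Fin n → Set
  FreeOccurs D x = (free x , true) ∈ literals D ⊎ (free x , false) ∈ literals D

  freeOccurs? : ∀ D → Decidable (FreeOccurs D)
  freeOccurs? D x = ((free x , true) ∈lits? literals D) ⊎-dec ((free x , false) ∈lits? literals D)

  -- The free copy takes the value `x` xor `offset x`, so a literal on it with sign `v` becomes one
  -- on `x` with sign `v xor offset x`. Here `v` is read off by testing whether the positive literal
  -- is present.
  sign : Clause (Fin n × Fin 2) → Fin n → Bool
  sign D x = does ((free x , true) ∈lits? literals D) xor offset x

  -- Literals on fixed copies are dropped: they are false unless the restriction already satisfies
  -- `D`. Listing variables rather than literals gives each variable a single sign, so the result is
  -- non-tautologous by construction.
  restrict : Clause (Fin n × Fin 2) → Clause (Fin n)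
  restrict D = clause (map (λ x → x , sign D x) (filter (freeOccurs? D) (allFin n)))
                      (Unique.map⁺ (cong proj₁) (Unique.filter⁺ (freeOccurs? D) (Unique.allFin⁺ n)))

  restrict-nontautologous : ∀ D → ¬ Tautologous (restrict D)
  restrict-nontautologous D (x , pos , neg) =
    contradiction (trans (∈-graph⁻ (sign D) _ pos) (sym (∈-graph⁻ (sign D) _ neg))) (λ ())

  SatisfiedBy : Clause (Fin n × Fin 2) → Set
  SatisfiedBy D = Any (λ x → Occurs D x (ρ x)) (allFin n)

  satisfiedBy? : Decidable SatisfiedBy
  satisfiedBy? D = any? (λ x → occurs? D x (ρ x)) (allFin n)

  satisfiedBy⇒satisfies : ∀ {D} α → SatisfiedBy D → Satisfies (extend α) D
  satisfiedBy⇒satisfies α sat =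
    let (x , _ , occurs) = find sat in lose occurs (setting-fixed (ρ x) (α x))

  sign-≡ : ∀ {D} → ¬ Tautologous D → ∀ {x v} → (free x , v) ∈ literals D →
           sign D x ≡ v xor offset x
  sign-≡ {D} nontaut {x} {v} l∈D with (free x , true) ∈lits? literals D | v
  ... | yes _  | true  = refl
  ... | yes t∈ | false = contradiction (free x , t∈ , l∈D) nontaut
  ... | no  t∉ | true  = contradiction l∈D t∉
  ... | no  _  | false = refl

  satisfies-restrict⁺ : ∀ {D} α → ¬ Tautologous D → ¬ SatisfiedBy D →
                        Satisfies (extend α) D → Satisfies α (restrict D)
  satisfies-restrict⁺ {D} α nontaut ¬satBy sat
    with ((x , j) , v) , l∈D , eq ← find sat
    with fixed-or-free (proj₁ (ρ x)) j
  -- A true literal on the fixed copy must carry the fixed bit, so the restriction alone would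
  -- satisfy `D`.
  ... | inj₁ refl = contradiction
    (lose (∈-allFin x) (subst (λ b → ((x , j) , b) ∈ literals D)
                              (trans (sym eq) (setting-fixed (ρ x) (α x))) l∈D))
    ¬satBy
  ... | inj₂ refl = lose (∈-map⁺ _ (∈-filter⁺ (freeOccurs? D) (∈-allFin x) (freeOccurs v l∈D)))
    (begin
      α x                             ≡⟨ sym (xor-cancelʳ (α x) (offset x)) ⟩
      (α x xor offset x) xor offset x ≡⟨ cong (_xor offset x) (trans (sym (setting-free (ρ x) (α x))) eq) ⟩
      v xor offset x                  ≡⟨ sym (sign-≡ {D} nontaut l∈D) ⟩
      sign D x                        ∎)
    where
    open ≡-Reasoning
    freeOccurs : ∀ v → (free x , v) ∈ literals D → FreeOccurs D x
    freeOccurs true  = inj₁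
    freeOccurs false = inj₂

  extend-free : ∀ {D} α → ¬ Tautologous D → ∀ {x v} → (free x , v) ∈ literals D →
                α x ≡ sign D x → extend α (free x) ≡ v
  extend-free {D} α nontaut {x} {v} l∈D αx≡sign = begin
    extend α (free x)            ≡⟨ setting-free (ρ x) (α x) ⟩
    α x xor offset x             ≡⟨ cong (_xor offset x) (trans αx≡sign (sign-≡ {D} nontaut l∈D)) ⟩
    (v xor offset x) xor offset x ≡⟨ xor-cancelʳ v (offset x) ⟩
    v                            ∎
    where open ≡-Reasoning

  satisfies-restrict⁻ : ∀ {D} α → ¬ Tautologous D →
                        Satisfies α (restrict D) → Satisfies (extend α) D
  satisfies-restrict⁻ {D} α nontaut sat
    with x , x∈ , αx≡sign ← find (Any.map⁻ sat)
    with ∈-filter⁻ (freeOccurs? D) {xs = allFin n} x∈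
  ... | _ , inj₁ t∈D = lose t∈D (extend-free {D} α nontaut t∈D αx≡sign)
  ... | _ , inj₂ f∈D = lose f∈D (extend-free {D} α nontaut f∈D αx≡sign)

  -- A variable with a free literal in `D` is hit by the choice that fixes that very copy to that
  -- sign. This ties the width to the count of hittable coordinates used in `escapes-≤`.
  width-restrict-≤ : ∀ D → clauseWidth (restrict D) ≤
    length (filter (Hitting.hittable? occurs? choices D) (allFin n))
  width-restrict-≤ D = subst (_≤ _) (sym (length-map _ (filter (freeOccurs? D) (allFin n))))
    (length-mono-≤ (filter⁺ (freeOccurs? D) (Hitting.hittable? occurs? choices D)
      (λ { refl (inj₁ t∈D) → lose (∈-choices _) t∈D
         ; refl (inj₂ f∈D) → lose (∈-choices _) f∈D })
      (⊆-refl {x = allFin n})))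

  restrictCNF : CNF (Fin n × Fin 2) → CNF (Fin n)
  restrictCNF H = map restrict (filter (λ D → ¬? (satisfiedBy? D)) H)

  -- Dropped clauses hold under every `extend α`; each other clause has the same truth value before
  -- and after restriction.
  viol-restrictCNF : ∀ α H → All (λ D → ¬ Tautologous D) H →
                     viol (restrictCNF H) α ≡ viol H (extend α)
  viol-restrictCNF α [] [] = refl
  viol-restrictCNF α (D ∷ H) (nontaut ∷ nontauts) with satisfiedBy? D
  ... | yes satBy = trans (viol-restrictCNF α H nontauts)
    (sym (length-filter-reject (falsifies? (extend α)) (λ f → f (satisfiedBy⇒satisfies {D} α satBy))))
  ... | no ¬satBy = step (falsifies? α (restrict D))
    where
    ih = viol-restrictCNF α H nontauts
    step : Dec (Falsifies α (restrict D)) →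
           viol (restrict D ∷ restrictCNF H) α ≡ viol (D ∷ H) (extend α)
    step (yes f) =
      trans (length-filter-accept (falsifies? α) f)
      (trans (cong suc ih)
      (sym (length-filter-accept (falsifies? (extend α)) (f ∘ satisfies-restrict⁺ {D} α nontaut ¬satBy))))
    step (no ¬f) =
      trans (length-filter-reject (falsifies? α) ¬f)
      (trans ih
      (sym (length-filter-reject (falsifies? (extend α)) (λ f → ¬f (f ∘ satisfies-restrict⁻ {D} α nontaut)))))

  -- The defining identity for `H`, read only at the points `extend α`, whose xor is `α`, is the
  -- identity required for `F`.
  restrictCNF-refutes : ∀ F H → IsSubCubeSumsRefutation (F ∘⊕) H →
                        IsSubCubeSumsRefutation F (restrictCNF H)
  restrictCNF-refutes F H (nontauts , viol-H) =
    All.map⁺ (All.universal restrict-nontautologous (filter (λ D → ¬? (satisfiedBy? D)) H)) , λ α → begin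
      viol F α                       ≡⟨ sym (viol-∘⊕ (λ x → setting-xor (ρ x) (α x)) F) ⟩
      viol (F ∘⊕) (extend α)         ≡⟨ viol-H (extend α) ⟩
      suc (viol H (extend α))        ≡⟨ cong suc (sym (viol-restrictCNF α H nontauts)) ⟩
      suc (viol (restrictCNF H) α)   ∎
    where open ≡-Reasoning

-- Choosing the restriction and bounding the size

width-< : ∀ {X d} → 0 <ℕ d → (F : CNF X) → All (λ C → clauseWidth C <ℕ d) F → width F <ℕ d
width-< 0<d [] [] = 0<d
width-< 0<d (C ∷ F) (C< ∷ F<) = ⊔-lub C< (width-< 0<d F F<)

module _ {n : ℕ} where

  -- A variable of which both copies occur counts once, since its choice is made once. This, not
  -- `clauseWidth`, is the exponent in the survival probability.
  variablesIn : Clause (Fin n × Fin 2) → ℕ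
  variablesIn D = length (filter (Hitting.hittable? occurs? choices D) (allFin n))

  wide : ℕ → CNF (Fin n × Fin 2) → CNF (Fin n × Fin 2)
  wide d = filter (λ D → d ≤? variablesIn D)

  width-restrictCNF-< : ∀ ρ {d} → 0 <ℕ d → ∀ H →
    All (Restriction.SatisfiedBy ρ) (wide d H) → width (Restriction.restrictCNF ρ H) <ℕ d
  width-restrictCNF-< ρ {d} 0<d H sats =
    width-< 0<d (restrictCNF H) (All.map⁺ (All.tabulate λ {D} D∈ →
      let (D∈H , ¬sat) = ∈-filter⁻ (λ D → ¬? (satisfiedBy? D)) {xs = H} D∈
      in ≤-<-trans (width-restrict-≤ D)
           (≰⇒> λ d≤ → ¬sat (All.lookup sats (∈-filter⁺ (λ D → d ≤? variablesIn D) D∈H d≤)))))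
    where open Restriction ρ

  satisfy-wide : ∀ d H → length H * 3 ^ d <ℕ 4 ^ d →
                 ∃[ ρ ] All (Restriction.SatisfiedBy ρ) (wide d H)
  satisfy-wide d H small =
    hitting Fin._≟_ (0F , true) choices (allFin n) (Unique.allFin⁺ n) (wide d H)
      (*-cancelʳ-< (4 ^ d) total _ (begin-strict
        -- There are four choices per variable, so `k` is 3. Multiplying the goal `total < 4 ^ l` by
        -- `4 ^ d` brings it into the form of this bound.
        total * 4 ^ d                           ≤⟨ sum-escapes-≤ choices refl (allFin n) d (wide d H) (All.all-filter _ H) ⟩
        length (wide d H) * 3 ^ d * 4 ^ l       ≤⟨ *-monoˡ-≤ (4 ^ l) (*-monoˡ-≤ (3 ^ d) (length-filter _ H)) ⟩
        length H * 3 ^ d * 4 ^ l                <⟨ *-monoˡ-< (4 ^ l) {{m^n≢0 4 l}} small ⟩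
        4 ^ d * 4 ^ l                           ≡⟨ *-comm (4 ^ d) (4 ^ l) ⟩
        4 ^ l * 4 ^ d                           ∎))
    where
    open Hitting {Hit = Occurs} occurs?
    open ≤-Reasoning
    l = length (allFin n)
    total = sum (map (escapes choices (allFin n)) (wide d H))

  size-bound : ∀ (F : CNF (Fin n)) {d} → IsMinimumRefutationWidth F d → 0 <ℕ d →
               ∀ H → IsSubCubeSumsRefutation (F ∘⊕) H → 4 ^ d ≤ length H * 3 ^ d
  size-bound F {d} (_ , minimal) 0<d H refutes = ≮⇒≥ λ small →
    let (ρ , sats) = satisfy-wide d H small
        open Restriction ρ
    in <⇒≱ (width-restrictCNF-< ρ 0<d H sats) (minimal (restrictCNF H) (restrictCNF-refutes F H refutes))

-- From base 4/3 to base 2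

^-distribʳ-* : ∀ m n o → (m * n) ^ o ≡ m ^ o * n ^ o
^-distribʳ-* m n zero = refl
^-distribʳ-* m n (suc o) = trans (cong (m * n *_) (^-distribʳ-* m n o)) (interchange m n (m ^ o) (n ^ o))
  where
  interchange : ∀ m n p q → m * n * (p * q) ≡ m * p * (n * q)
  interchange = solve-∀

-- 2 * 3³ = 54 ≤ 64 = 4³.
2^d≤s³ : ∀ d s → 4 ^ d ≤ s * 3 ^ d → 2 ^ d ≤ s ^ 3
2^d≤s³ d s 4^d≤ = *-cancelʳ-≤ (2 ^ d) (s ^ 3) (27 ^ d) {{m^n≢0 27 d}} (begin
  2 ^ d * 27 ^ d     ≡⟨ sym (^-distribʳ-* 2 27 d) ⟩
  54 ^ d             ≤⟨ ^-monoˡ-≤ d (m≤m+n 54 10) ⟩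
  (4 ^ 3) ^ d        ≡⟨ ^-swap 4 3 d ⟩
  (4 ^ d) ^ 3        ≤⟨ ^-monoˡ-≤ 3 4^d≤ ⟩
  (s * 3 ^ d) ^ 3    ≡⟨ ^-distribʳ-* s (3 ^ d) 3 ⟩
  s ^ 3 * (3 ^ d) ^ 3 ≡⟨ cong (s ^ 3 *_) (^-swap 3 d 3) ⟩
  s ^ 3 * 27 ^ d     ∎)
  where
  open ≤-Reasoning
  ^-swap : ∀ m n o → (m ^ n) ^ o ≡ (m ^ o) ^ n
  ^-swap m n o = trans (^-*-assoc m n o) (trans (cong (m ^_) (*-comm n o)) (sym (^-*-assoc m o n)))

theorem4p15 : ∃[ ε ] ∃[ d₀ ] (0ℚ < ε ×
    (∀ (n : ℕ) (F : CNF (Fin n)) → Unsatisfiable F →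
    ∀ (d : ℕ) → IsMinimumRefutationWidth F d → d₀ ≤ d →
    ∀ (H : CNF (Fin n × Fin 2)) → IsSubCubeSumsRefutation (F ∘⊕) H →
    2^[ ε * d ]≤ combinatorialSize H))
-- The rate 1/3 comes from `2^d≤s³`. The threshold 1 is there because an empty restricted family has
-- width 0, which is less than `d` only for positive `d`.
theorem4p15 = (ℤ.+ 1 / 3) , 1 , *<* (ℤ.+<+ (s≤s z≤n)) ,
  λ n F _ d minWidth 1≤d H refutes →
    subst (λ e → 2 ^ e ≤ length H ^ 3) (sym (*-identityˡ d))
      (2^d≤s³ d (length H) (size-bound F minWidth 1≤d H refutes))
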